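{- For every integer $k\ge 3$ there exists a constant $\varepsilon>0$ such that for all $n\in\mathbb{N}$ there is a sentence $\phi\in\mathcal{L}^{k+1}$ with $|\phi|\ge n$ such that $\phi$ has an equivalent sentence in $\mathcal{L}^k$, but every sentence of $\mathcal{L}^k$ equivalent to $\phi$ has size at least $2^{\varepsilon\cdot|\phi|}$.
   Context: All structures are finite and relational, with a finite signature (the signature is not fixed in advance and may depend on $n$). $\mathcal{L}^k$ is the set of first-order formulas (with equality) using only the variables $x_1,\dots,x_k$ (variables may be requantified). The size $|\phi|$ of a formula is the total number of symbols in it. Two sentences over the same signature are equivalent if they are satisfied by the same (finite) structures. -}

module Defs where

open import Data.Bool using (Bool; T)
open import Data.Fin using (Fin)
open import Data.Integer using () renaming (∣_∣ to abs)
open import Data.Nat using (ℕ; _+_; _*_; _^_; _≤_; NonZero)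
open import Data.Product using (Σ-syntax; ∃-syntax; _×_; proj₁)
open import Data.Rational using (ℚ; ↥_; ↧ₙ_)
open import Data.Sum using (_⊎_)
open import Data.Vec using (Vec; map)
open import Data.Vec.Functional using (Vector; updateAt)
open import Data.Vec.Membership.Propositional using (_∈_)
open import Function using (const; _⇔_)
open import Relation.Binary.PropositionalEquality using (_≡_; _≢_)
open import Relation.Nullary using (¬_)

record Signature : Set where
  field
    symbols : ℕ
    arity   : Fin symbols → ℕ
    arity≢0 : ∀ R → NonZero (arity R)

  Symbol : Set
  Symbol = Fin symbols

open Signature public

-- Universes are nonempty, as usual in first-order logic. Relations are
-- Bool-valued so that the logic of finite structures is the classical one
-- (satisfaction is decidable).
record Structure (σ : Signature) : Set where
  field
    card   : ℕ
    card≢0 : NonZero card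

  Universe : Set
  Universe = Fin card

  field
    rel : (R : Symbol σ) → Vec Universe (arity σ R) → Bool

open Structure public

infix  8 _≐_
infix  7 ¬̇_
infixr 6 _∧̇_
infixr 5 _∨̇_

-- Formulas whose variables, free or bound, are among k fixed names. The names
-- are not de Bruijn indices: a quantifier may rebind a variable already in use.
data Formula (σ : Signature) (k : ℕ) : Set where
  atom    : (R : Symbol σ) → Vec (Fin k) (arity σ R) → Formula σ k
  _≐_     : Fin k → Fin k → Formula σ k
  ¬̇_      : Formula σ k → Formula σ k
  _∧̇_ _∨̇_ : Formula σ k → Formula σ k → Formula σ k
  ∃̇ ∀̇     : Fin k → Formula σ k → Formula σ k

module _ {σ : Signature} {k : ℕ} where

  FreeIn : Fin k → Formula σ k → Set
  FreeIn x (atom R ys) = x ∈ ys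
  FreeIn x (y ≐ z)     = x ≡ y ⊎ x ≡ z
  FreeIn x (¬̇ φ)       = FreeIn x φ
  FreeIn x (φ ∧̇ ψ)     = FreeIn x φ ⊎ FreeIn x ψ
  FreeIn x (φ ∨̇ ψ)     = FreeIn x φ ⊎ FreeIn x ψ
  FreeIn x (∃̇ y φ)     = x ≢ y × FreeIn x φ
  FreeIn x (∀̇ y φ)     = x ≢ y × FreeIn x φ

  -- The length of the string in which formulas are written
  --   R y₁ … yᵣ    y = z    ¬ φ    ( φ ∧ ψ )    ( φ ∨ ψ )    ∃ y φ    ∀ y φ
  -- with each variable and each relation name a single symbol.
  size : Formula σ k → ℕ
  size (atom R ys) = 1 + arity σ R
  size (y ≐ z)     = 3
  size (¬̇ φ)       = 1 + size φ
  size (φ ∧̇ ψ)     = 3 + (size φ + size ψ)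
  size (φ ∨̇ ψ)     = 3 + (size φ + size ψ)
  size (∃̇ y φ)     = 2 + size φ
  size (∀̇ y φ)     = 2 + size φ

Assignment : {σ : Signature} → Structure σ → ℕ → Set
Assignment A k = Vector (Universe A) k

infix 4 _,_⊨_ _⊨_ _≣_

_,_⊨_ : {σ : Signature} {k : ℕ} (A : Structure σ) → Assignment A k → Formula σ k → Set
A , α ⊨ atom R ys = T (rel A R (map α ys))
A , α ⊨ y ≐ z     = α y ≡ α z
A , α ⊨ ¬̇ φ       = ¬ (A , α ⊨ φ)
A , α ⊨ φ ∧̇ ψ     = (A , α ⊨ φ) × (A , α ⊨ ψ)
A , α ⊨ φ ∨̇ ψ     = (A , α ⊨ φ) ⊎ (A , α ⊨ ψ)
A , α ⊨ ∃̇ y φ     = ∃[ a ] (A , updateAt α y (const a) ⊨ φ)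
A , α ⊨ ∀̇ y φ     = ∀ a → (A , updateAt α y (const a) ⊨ φ)

Sentence : Signature → ℕ → Set
Sentence σ k = Σ[ φ ∈ Formula σ k ] (∀ x → ¬ FreeIn x φ)

∥_∥ : {σ : Signature} {k : ℕ} → Sentence σ k → ℕ
∥ φ ∥ = size (proj₁ φ)

-- The truth value of a sentence does not depend on the assignment, and
-- assignments exist because universes are nonempty.
_⊨_ : {σ : Signature} {k : ℕ} → Structure σ → Sentence σ k → Set
A ⊨ φ = ∀ α → A , α ⊨ proj₁ φ

_≣_ : {σ : Signature} {k l : ℕ} → Sentence σ k → Sentence σ l → Set
_≣_ {σ} φ ψ = (A : Structure σ) → (A ⊨ φ) ⇔ (A ⊨ ψ)

-- 2 ^ (ε m) ≤ s for positive ε = p / q, raised to the q-th power: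
-- 2 ^ (p m) ≤ s ^ q.
2^[_·_]≤_ : ℚ → ℕ → ℕ → Set
2^[ ε · m ]≤ s = 2 ^ (abs (↥ ε) * m) ≤ s ^ (↧ₙ ε)

{-# OPTIONS --safe #-}

-- Fix m relation symbols R_j, two more symbols Q⁺, Q⁻, all of arity k, and say
-- that two k-tuples which agree on k - 1 elements clash if one is in Q⁺, the
-- other in Q⁻, and they belong to the same R_j. With k + 1 variables the
-- existence of a clash is stated in size O(m); with k variables it can be
-- stated by a case distinction over the 2^m possible types of a tuple.
--
-- For the lower bound, take structures in which the relations on a tuple of
-- distinct elements depend only on a colour, a pair (type, sign), and in which
-- changing one element of a tuple can produce any colour that occurs. With k
-- variables, a quantifier forgets the colour of the present tuple, so that it
-- only asks whether some colour occurs that satisfies its body. Going through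
-- ψ bottom-up, choose greedily one sign for one further type per quantifier so
-- as to make its answer independent of the signs of all other types. If
-- |ψ| < 2^m, then some type t remains free, and ψ cannot see whether t occurs
-- with one sign only or with both, that is, whether there is a clash.

module Submission where

open import Data.Bool using (Bool; true; false; not; T; _∧_; T?)
open import Data.Bool.Properties using (T-∧)
open import Data.Fin using (Fin; zero; suc; toℕ; combine; punchOut; finToFun; funToFin)
open import Data.Fin.Permutation using (Permutation′; permutation)
open import Data.Fin.Properties
  using (_≟_; any?; all?; ¬∀⟶∃¬; pigeonhole; injective⇒≤; punchOut-injective; toℕ-injective;
         toℕ-fromℕ<; toℕ<n; toℕ-combine; combine-injectiveˡ; <⇒≢; funToFin-finToFin)
open import Data.Integer using (1ℤ)
open import Data.List using (List; []; _∷_; length; foldr; allFin)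
open import Data.List.Membership.DecPropositional using () renaming (_∈?_ to ∈ˡ-dec)
open import Data.List.Membership.Propositional using () renaming (_∈_ to _∈ˡ_; _∉_ to _∉ˡ_)
open import Data.List.Membership.Propositional.Properties using (∈-allFin)
open import Data.List.Membership.Setoid.Properties using (index-injective)
open import Data.List.Properties using (length-tabulate)
open import Data.List.Relation.Unary.Any as Any using (here; there)
open import Data.Nat using (ℕ; zero; suc; _+_; _*_; _^_; _≤_)
open import Data.Nat.Coprimality using (1-coprimeTo)
open import Data.Nat.DivMod
  using (_%_; _mod_; m%n<n; m%n%n≡m%n; %-distribˡ-+; [m+kn]%n≡m%n; m<n⇒m%n≡m)
open import Data.Nat.Properties
  using (≤-trans; ≤-reflexive; m≤m+n; m≤n+m; n<1+n; n≤1+n; 1+n≰n; +-assoc; +-comm; +-monoʳ-≤;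
         +-monoˡ-≤; *-identityˡ; *-distribˡ-+; *-monoʳ-≤; m≤m*n; m≤n*m; ^-*-assoc; ^-monoˡ-≤;
         ^-monoʳ-≤; +-0-commutativeMonoid; module ≤-Reasoning)
open import Data.Nat.Solver using (module +-*-Solver)
open import Data.Product using (_×_; _,_; proj₁; proj₂; ∃; Σ-syntax)
open import Data.Rational using (ℚ; mkℚ; Positive)
open import Data.Sum using (_⊎_; inj₁; inj₂)
open import Data.Unit using (tt)
open import Data.Vec using (Vec; _∷_; lookup; map; tabulate)
open import Data.Vec.Functional using (Vector; updateAt)
open import Data.Vec.Functional.Properties using (updateAt-updates; updateAt-minimal; map-updateAt)
open import Data.Vec.Properties using (lookup-map; map-cong; tabulate-∘; lookup∘tabulate)
open import Defs
open import Function using (const; id; _∘_; _⇔_; mk⇔; Equivalence)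
open import Relation.Binary.PropositionalEquality
  using (_≡_; _≢_; _≗_; refl; sym; trans; cong; cong₂; subst; subst₂; setoid; module ≡-Reasoning)
open import Relation.Nullary
  using (¬_; Dec; yes; no; ⌊_⌋; contradiction; ¬?; _×-dec_; _⊎-dec_; _→-dec_)
open import Relation.Nullary.Decidable using (toWitness; fromWitness; decidable-stable)
open import Algebra.Properties.CommutativeMonoid.Sum +-0-commutativeMonoid
  using (sum; sum-permute; sum-cong-≗)

-- Tuples, injections and sums modulo a number.

infixl 10 _[_≔_]

_[_≔_] : ∀ {k} {A : Set} → Vector A k → Fin k → A → Vector A k
α [ y ≔ a ] = updateAt α y (const a)

Distinct : ∀ {n} {A : Set} → Vector A n → Set
Distinct α = ∀ x y → α x ≡ α y → x ≡ y

abstract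
  distinct? : ∀ {n u} (α : Vector (Fin u) n) → Dec (Distinct α)
  distinct? α = all? λ x → all? λ y → (α x ≟ α y) →-dec (x ≟ y)

-- A missed value could be punched out, leaving an injection of `suc n` elements into `n`.
distinct⇒surjective : ∀ {n} (f : Fin n → Fin n) → Distinct f → ∀ y → ∃ λ x → f x ≡ y
distinct⇒surjective {suc n} f f-distinct y with any? (λ x → f x ≟ y)
... | yes found = found
... | no missed = contradiction
  (injective⇒≤ {f = λ x → punchOut (y≢f x)}
    (λ {x} {x′} eq → f-distinct x x′ (punchOut-injective (y≢f x) (y≢f x′) eq)))
  1+n≰n
  where
  y≢f : ∀ x → y ≢ f x
  y≢f x y≡fx = missed (x , sym y≡fx)

sum-reindex : ∀ {n} (v : Vector ℕ n) (f : Fin n → Fin n) → Distinct f → sum (v ∘ f) ≡ sum v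
sum-reindex {n} v f f-distinct = sym (sum-permute v π)
  where
  f⁻¹ : Fin n → Fin n
  f⁻¹ y = proj₁ (distinct⇒surjective f f-distinct y)
  f∘f⁻¹ : ∀ y → f (f⁻¹ y) ≡ y
  f∘f⁻¹ y = proj₂ (distinct⇒surjective f f-distinct y)
  π : Permutation′ n
  π = permutation f f⁻¹
    f∘f⁻¹
    (λ x → f-distinct _ _ (f∘f⁻¹ (f x)))

-- The other entries contribute a constant `s`, so the new entry alone can steer the residue of the
-- sum.
sum-update : ∀ {k u} (α : Vector (Fin u) k) (y : Fin k) →
  ∃ λ s → ∀ a → sum (toℕ ∘ α [ y ≔ a ]) ≡ toℕ a + s
sum-update α zero    = sum (toℕ ∘ α ∘ suc) , λ a → refl
sum-update α (suc y) with sum-update (α ∘ suc) y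
... | s , eq = toℕ (α zero) + s , λ a → trans (cong (toℕ (α zero) +_) (eq a))
  (solve 3 (λ x a s → x :+ (a :+ s) := a :+ (x :+ s)) refl (toℕ (α zero)) (toℕ a) s)
  where open +-*-Solver

-- Pigeonhole: `k` entries cannot cover `k + 1` distinct points.
avoid : ∀ {k} {u} (e : Fin (suc k) → Fin u) → Distinct e → (α : Vector (Fin u) k) →
  ∃ λ j → ∀ x → e j ≢ α x
avoid {k} e e-distinct α
  with ¬∀⟶∃¬ (suc k) (λ j → ∃ λ x → e j ≡ α x) (λ j → any? (λ x → e j ≟ α x)) not-all
  where
  not-all : ¬ (∀ j → ∃ λ x → e j ≡ α x)
  not-all hit with pigeonhole (n<1+n k) (proj₁ ∘ hit)
  ... | i , j , i<j , eq = <⇒≢ i<j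
    (e-distinct i j (trans (proj₂ (hit i)) (trans (cong α eq) (sym (proj₂ (hit j))))))
... | j , missed = j , λ x eq → missed (x , eq)

-- Since `M` is congruent to -1 modulo `suc M`, the term `i + s * M` stands for `i - s` without
-- subtraction. The multiple by `j` vanishes, which leaves `j` free for choosing a fresh point.
modular-solution : ∀ s i j M →
  (suc M * j + (i + s * M) % suc M + s) % suc M ≡ i % suc M
modular-solution s i j M = begin
  (suc M * j + x % suc M + s) % suc M       ≡⟨ cong (_% suc M) (rearrange j (x % suc M) s (suc M)) ⟩
  ((x % suc M + s) + j * suc M) % suc M     ≡⟨ [m+kn]%n≡m%n (x % suc M + s) j (suc M) ⟩
  (x % suc M + s) % suc M                   ≡⟨ %-distribˡ-+ (x % suc M) s (suc M) ⟩
  (x % suc M % suc M + s % suc M) % suc M   ≡⟨ cong (λ z → (z + s % suc M) % suc M) (m%n%n≡m%n x (suc M)) ⟩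
  (x % suc M + s % suc M) % suc M           ≡⟨ %-distribˡ-+ x s (suc M) ⟨
  (x + s) % suc M                           ≡⟨ cong (_% suc M) (complete s i M) ⟩
  (i + s * suc M) % suc M                   ≡⟨ [m+kn]%n≡m%n i s (suc M) ⟩
  i % suc M                                 ∎
  where
  open ≡-Reasoning
  open +-*-Solver
  x : ℕ
  x = i + s * M
  rearrange : ∀ j r s N → N * j + r + s ≡ (r + s) + j * N
  rearrange = solve 4 (λ j r s N → N :* j :+ r :+ s := (r :+ s) :+ j :* N) refl
  complete : ∀ s i M → i + s * M + s ≡ i + s * suc M
  complete = solve 3 (λ s i M → i :+ s :* M :+ s := i :+ s :* (con 1 :+ M)) refl

-- Equality types of tuples.

infix 4 _≼_

_≼_ : ∀ {k u} → Vector (Fin u) k → Vector (Fin u) k → Set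
α ≼ β = ∀ x y → α x ≡ α y → β x ≡ β y

≼-distinct : ∀ {k u} {α β : Vector (Fin u) k} → β ≼ α → Distinct α → Distinct β
≼-distinct β≼α d x y eq = d x y (β≼α x y eq)

Fresh : ∀ {k u} → Fin k → Fin u → Vector (Fin u) k → Set
Fresh y a α = ∀ x → x ≢ y → a ≢ α x

-- A fresh `a` creates no new equality on the left, so nothing is asked of `b`.
update-≼ : ∀ {k u} {α β : Vector (Fin u) k} (y : Fin k) {a b : Fin u} →
  Fresh y a α → α ≼ β → α [ y ≔ a ] ≼ β [ y ≔ b ]
update-≼ {α = α} {β} y fresh α≼β z w eq with z ≟ y | w ≟ y
... | yes refl | yes refl = refl
... | yes refl | no w≢y = contradiction
  (trans (sym (updateAt-updates z α)) (trans eq (updateAt-minimal w y α w≢y))) (fresh w w≢y)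
... | no z≢y | yes refl = contradiction
  (trans (sym (updateAt-updates w α)) (trans (sym eq) (updateAt-minimal z y α z≢y))) (fresh z z≢y)
... | no z≢y | no w≢y = begin
  (β [ y ≔ _ ]) z  ≡⟨ updateAt-minimal z y β z≢y ⟩
  β z              ≡⟨ α≼β z w (trans (sym (updateAt-minimal z y α z≢y)) (trans eq (updateAt-minimal w y α w≢y))) ⟩
  β w              ≡⟨ updateAt-minimal w y β w≢y ⟨
  (β [ y ≔ _ ]) w  ∎
  where open ≡-Reasoning

update-repeat : ∀ {k u} (α : Vector (Fin u) k) (y x : Fin k) →
  α [ y ≔ α x ] ≗ α ∘ (id [ y ≔ x ])
update-repeat α y x z = sym (map-updateAt (λ _ → refl) id y z)

repeat-≼ : ∀ {k u} {α β : Vector (Fin u) k} (y x : Fin k) →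
  α ≼ β → α [ y ≔ α x ] ≼ β [ y ≔ β x ]
repeat-≼ {α = α} {β} y x α≼β z w eq = trans (update-repeat β y x z)
  (trans (α≼β _ _ (trans (sym (update-repeat α y x z)) (trans eq (update-repeat α y x w))))
    (sym (update-repeat β y x w)))

¬distinct-repeat : ∀ {k u} (α : Vector (Fin u) k) {x y : Fin k} →
  x ≢ y → ¬ Distinct (α [ y ≔ α x ])
¬distinct-repeat α {x} {y} x≢y d =
  x≢y (d x y (trans (updateAt-minimal x y α x≢y) (sym (updateAt-updates y α))))

update-distinct : ∀ {k u} {α : Vector (Fin u) k} (y : Fin k) {a : Fin u} →
  Fresh y a α → Distinct α → Distinct (α [ y ≔ a ])
update-distinct {α = α} y fresh d z w eq with z ≟ y | w ≟ y
... | yes refl | yes refl = refl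
... | yes refl | no w≢y = contradiction
  (trans (sym (updateAt-updates z α)) (trans eq (updateAt-minimal w y α w≢y))) (fresh w w≢y)
... | no z≢y | yes refl = contradiction
  (trans (sym (updateAt-updates w α)) (trans (sym eq) (updateAt-minimal z y α z≢y))) (fresh z z≢y)
... | no z≢y | no w≢y = d z w
  (trans (sym (updateAt-minimal z y α z≢y)) (trans eq (updateAt-minimal w y α w≢y)))

-- Decidability of satisfaction in finite structures.

infix 4 _,_⊨?_

_,_⊨?_ : ∀ {σ k} (A : Structure σ) (α : Assignment A k) (θ : Formula σ k) → Dec (A , α ⊨ θ)
A , α ⊨? atom R ys = T? (rel A R (map α ys))
A , α ⊨? x ≐ y     = α x ≟ α y
A , α ⊨? ¬̇ θ       = ¬? (A , α ⊨? θ)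
A , α ⊨? θ ∧̇ χ     = (A , α ⊨? θ) ×-dec (A , α ⊨? χ)
A , α ⊨? θ ∨̇ χ     = (A , α ⊨? θ) ⊎-dec (A , α ⊨? χ)
A , α ⊨? ∃̇ y θ     = any? λ a → A , α [ y ≔ a ] ⊨? θ
A , α ⊨? ∀̇ y θ     = all? λ a → A , α [ y ≔ a ] ⊨? θ

-- Coloured structures and similar tuples.

uniform : ℕ → ℕ → Signature
uniform ℓ k′ = record { symbols = ℓ ; arity = const (suc k′) ; arity≢0 = λ _ → _ }

module Coloured {τ ℓ : ℕ} (k′ : ℕ) (holds : Fin ℓ → Fin τ × Bool → Bool) where

  -- There is one index more than there are types, so that every type can occur and one of them with
  -- both signs.
  k N : ℕ
  k = suc k′
  N = suc τ

  -- Each residue class modulo N has k + 1 points, so one lies outside a given tuple.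
  Point : Set
  Point = Fin (suc k * N)

  Tuple : Set
  Tuple = Vector Point k

  Colouring : Set
  Colouring = Fin N → Fin τ × Bool

  signature : Signature
  signature = uniform ℓ k′

  -- The sum ignores the order of the entries, while changing any single entry can move it to any
  -- residue.
  index : Tuple → Fin N
  index α = sum (toℕ ∘ α) mod N

  structure : Colouring → Structure signature
  structure P = record
    { card   = suc k * N
    ; card≢0 = _
    ; rel    = λ R v → ⌊ distinct? (lookup v) ⌋ ∧ holds R (P (index (lookup v)))
    }

  index-cong : {α β : Tuple} → α ≗ β → index α ≡ index β
  index-cong eq = cong (_mod N) (sum-cong-≗ (cong toℕ ∘ eq))

  index-reindex : (α : Tuple) (f : Fin k → Fin k) → Distinct f → index (α ∘ f) ≡ index α
  index-reindex α f d = cong (_mod N) (sum-reindex (toℕ ∘ α) f d)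

  mod-≡ : ∀ s (i : Fin N) → s % N ≡ toℕ i % N → s mod N ≡ i
  mod-≡ s i eq = toℕ-injective (trans (toℕ-fromℕ< (m%n<n s N)) (trans eq (m<n⇒m%n≡m (toℕ<n i))))

  realise : (α : Tuple) (y : Fin k) (i : Fin N) →
    ∃ λ a → (∀ x → a ≢ α x) × index (α [ y ≔ a ]) ≡ i
  realise α y i = combine (proj₁ free) r , proj₂ free ,
    mod-≡ (sum (toℕ ∘ α [ y ≔ combine (proj₁ free) r ])) i (begin
      sum (toℕ ∘ α [ y ≔ combine (proj₁ free) r ]) % N  ≡⟨ cong (_% N) (proj₂ (sum-update α y) _) ⟩
      (toℕ (combine (proj₁ free) r) + s) % N            ≡⟨ cong (λ a → (a + s) % N) (toℕ-combine (proj₁ free) r) ⟩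
      (N * toℕ (proj₁ free) + toℕ r + s) % N            ≡⟨ cong (λ a → (N * toℕ (proj₁ free) + a + s) % N)
                                                             (toℕ-fromℕ< (m%n<n (toℕ i + s * τ) N)) ⟩
      (N * toℕ (proj₁ free) + (toℕ i + s * τ) % N + s) % N  ≡⟨ modular-solution s (toℕ i) (toℕ (proj₁ free)) τ ⟩
      toℕ i % N                                         ∎)
    where
    open ≡-Reasoning
    s : ℕ
    s = proj₁ (sum-update α y)
    r : Fin N
    r = (toℕ i + s * τ) mod N
    free : ∃ λ j → ∀ x → combine j r ≢ α x
    free = avoid (λ j → combine j r) (λ j j′ → combine-injectiveˡ j r j′ r) α

  -- A test tuple: its colour is the one that `extend` places at index `zero`.
  seed : ∃ λ (α : Tuple) → Distinct α × index α ≡ zero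
  seed = α [ zero ≔ a ] , update-distinct zero (λ x _ → fresh x) α-distinct , index≡
    where
    α : Tuple
    α x = combine (suc x) zero
    α-distinct : Distinct α
    α-distinct x y eq with combine-injectiveˡ (suc x) zero (suc y) zero eq
    ... | refl = refl
    a : Point
    a = proj₁ (realise α zero zero)
    fresh : ∀ x → a ≢ α x
    fresh = proj₁ (proj₂ (realise α zero zero))
    index≡ : index (α [ zero ≔ a ]) ≡ zero
    index≡ = proj₂ (proj₂ (realise α zero zero))

  -- Colours are compared on tuples of distinct entries only: no relation holds on other tuples, so
  -- their index is invisible.
  record Similar (P P′ : Colouring) (α α′ : Tuple) : Set where
    field
      to     : α ≼ α′
      from   : α′ ≼ α
      colour : Distinct α → P (index α) ≡ P′ (index α′)

  open Similar

  Similar-sym : ∀ {P P′ α α′} → Similar P P′ α α′ → Similar P′ P α′ α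
  Similar-sym s = record
    { to = from s ; from = to s ; colour = λ d → sym (colour s (≼-distinct (to s) d)) }

  Similar-distinct : ∀ {P P′ : Colouring} {α α′ : Tuple} → Distinct α → Distinct α′ →
    P (index α) ≡ P′ (index α′) → Similar P P′ α α′
  Similar-distinct {α = α} {α′} d d′ eq = record
    { to = λ x y e → cong α′ (d x y e) ; from = λ x y e → cong α (d′ x y e) ; colour = λ _ → eq }

  T-rel : ∀ (P : Colouring) R v →
    T (rel (structure P) R v) ⇔ (Distinct (lookup v) × T (holds R (P (index (lookup v)))))
  T-rel P R v = mk⇔
    (λ t → let d , h = Equivalence.to split t in toWitness d , h)
    (λ (d , h) → Equivalence.from split (fromWitness d , h))
    where
    split : T (rel (structure P) R v) ⇔ (T ⌊ distinct? (lookup v) ⌋ × T (holds R (P (index (lookup v)))))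
    split = T-∧ {⌊ distinct? (lookup v) ⌋}

  -- If the atom holds, its `k` arguments have distinct values, so `ys` lists all variables in some
  -- order. Hence `α` is distinct, and by symmetry of the sum the atom speaks of the colour of `α`
  -- itself.
  atom-transfer : ∀ {P P′ α α′} → Similar P P′ α α′ → ∀ R (ys : Vec (Fin k) k) →
    T (rel (structure P) R (map α ys)) → T (rel (structure P′) R (map α′ ys))
  atom-transfer {P} {P′} {α} {α′} s R ys t = Equivalence.from (T-rel P′ R (map α′ ys))
    ( (λ i j eq → ys-distinct i j
        (α′-distinct _ _ (trans (sym (lookup-map i α′ ys)) (trans eq (lookup-map j α′ ys)))))
    , subst (T ∘ holds R) colour≡ (proj₂ unfolded) )
    where
    unfolded : Distinct (lookup (map α ys)) × T (holds R (P (index (lookup (map α ys)))))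
    unfolded = Equivalence.to (T-rel P R (map α ys)) t
    ys-distinct : Distinct (lookup ys)
    ys-distinct i j eq = proj₁ unfolded i j
      (trans (lookup-map i α ys) (trans (cong α eq) (sym (lookup-map j α ys))))
    α-distinct : Distinct α
    α-distinct x y eq with distinct⇒surjective (lookup ys) ys-distinct x
                         | distinct⇒surjective (lookup ys) ys-distinct y
    ... | i , refl | j , refl = cong (lookup ys)
      (proj₁ unfolded i j (trans (lookup-map i α ys) (trans eq (sym (lookup-map j α ys)))))
    α′-distinct : Distinct α′
    α′-distinct = ≼-distinct (from s) α-distinct
    index-map : ∀ (β : Tuple) → index (lookup (map β ys)) ≡ index β
    index-map β = trans (index-cong (λ i → lookup-map i β ys)) (index-reindex β (lookup ys) ys-distinct)
    colour≡ : P (index (lookup (map α ys))) ≡ P′ (index (lookup (map α′ ys)))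
    colour≡ = trans (cong P (index-map α)) (trans (colour s α-distinct) (cong P′ (sym (index-map α′))))

  -- Invariant predicates and the greedy choice of signs.

  Predicate : Set₁
  Predicate = Colouring → Tuple → Set

  -- Types outside `D` are still free: they may occur with either sign or with both.
  record Admits (f : Fin τ → Bool) (D : List (Fin τ)) (P : Colouring) : Set where
    field
      hits   : ∀ t → ∃ λ i → proj₁ (P i) ≡ t
      agrees : ∀ i → proj₁ (P i) ∈ˡ D → proj₂ (P i) ≡ f (proj₁ (P i))

  open Admits

  -- Truth may depend on the present tuple, but not on the signs with which free types occur
  -- elsewhere.
  Invariant : (Fin τ → Bool) → List (Fin τ) → Predicate → Set
  Invariant f D S = ∀ {P P′ : Colouring} {α α′ : Tuple} → Admits f D P → Admits f D P′ →
    Similar P P′ α α′ → S P α → S P′ α′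

  -- One back-and-forth move. If the witness repeats an entry, or the updated tuple has a repetition
  -- elsewhere, equality types decide. Colours matter only when the updated tuple is distinct, and
  -- then `answer` names an index to aim for.
  respond : ∀ {f D} {S : Predicate} → Invariant f D S →
    ∀ (y : Fin k) {P P′ : Colouring} {α α′ : Tuple} →
    Admits f D P → Admits f D P′ → Similar P P′ α α′ →
    (∀ β → Distinct β → S P β → ∃ λ i → ∀ γ → Distinct γ → index γ ≡ i → S P′ γ) →
    (∃ λ a → S P (α [ y ≔ a ])) → ∃ λ a → S P′ (α′ [ y ≔ a ])
  respond {f} {D} {S} inv y {P} {P′} {α} {α′} adm adm′ s answer (a , Sa) =
    by-freshness (any? (λ x → ¬? (x ≟ y) ×-dec (a ≟ α x)))
    where
    by-distinctness : Fresh y a α → Dec (Distinct (α [ y ≔ a ])) → ∃ λ a′ → S P′ (α′ [ y ≔ a′ ])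
    by-distinctness fresh (yes d) =
      let i , answers = answer (α [ y ≔ a ]) d Sa
          a′ , fresh′ , index≡i = realise α′ y i
      in a′ , answers (α′ [ y ≔ a′ ]) (≼-distinct (update-≼ y (λ x _ → fresh′ x) (from s)) d) index≡i
    by-distinctness fresh (no ¬d) =
      -- Any index will do: the updated tuple keeps a repetition, which hides its colour.
      let a′ , fresh′ , _ = realise α′ y zero
      in a′ , inv adm adm′ (record
           { to     = update-≼ y fresh (to s)
           ; from   = update-≼ y (λ x _ → fresh′ x) (from s)
           ; colour = λ d → contradiction d ¬d
           }) Sa
    by-freshness : Dec (∃ λ x → x ≢ y × a ≡ α x) → ∃ λ a′ → S P′ (α′ [ y ≔ a′ ])
    by-freshness (yes (x , x≢y , a≡αx)) = α′ x , inv adm adm′ (record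
      { to     = repeat-≼ y x (to s)
      ; from   = repeat-≼ y x (from s)
      ; colour = λ d → contradiction d (¬distinct-repeat α x≢y)
      }) (subst (λ b → S P (α [ y ≔ b ])) a≡αx Sa)
    by-freshness (no a∉α) =
      by-distinctness (λ x x≢y a≡αx → a∉α (x , x≢y , a≡αx)) (distinct? (α [ y ≔ a ]))

  -- `restricts` lets invariance obtained earlier survive later choices.
  record Fixing (f : Fin τ → Bool) (D : List (Fin τ)) (n : ℕ) (S : Predicate) : Set where
    field
      signs     : Fin τ → Bool
      fixed     : List (Fin τ)
      restricts : ∀ {P} → Admits signs fixed P → Admits f D P
      short     : length fixed ≤ length D + n
      invariant : Invariant signs fixed S

  open Fixing

  -- Index `zero` is the spare one, used to test a colour or to give a type a second sign.
  extend : (Fin τ → Bool) → Fin τ × Bool → Colouring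
  extend f c zero    = c
  extend f c (suc t) = t , f t

  extend-admits : ∀ {f D t s} → t ∉ˡ D → Admits f D (extend f (t , s))
  extend-admits t∉D = record
    { hits   = λ t → suc t , refl
    ; agrees = λ { zero t∈D → contradiction t∈D t∉D ; (suc t) _ → refl }
    }

  fix-admits : ∀ {f D t s P} → t ∉ˡ D → Admits (f [ t ≔ s ]) (t ∷ D) P → Admits f D P
  fix-admits {f} {D} {t} {s} {P} t∉D adm = record
    { hits   = hits adm
    ; agrees = λ i m → trans (agrees adm i (there m))
        (updateAt-minimal (proj₁ (P i)) t f (λ eq → t∉D (subst (_∈ˡ D) eq m)))
    }

  fix-∃ : ∀ {f D} {S : Predicate} → (∀ P α → Dec (S P α)) → Invariant f D S →
    ∀ y → Fixing f D 1 (λ P α → ∃ λ a → S P (α [ y ≔ a ]))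
  fix-∃ {f} {D} {S} S? inv y = by-search
    (any? λ t → ¬? (∈ˡ-dec _≟_ t D) ×-dec (Good? (t , true) ⊎-dec Good? (t , false)))
    where
    -- One tuple suffices as a test: by invariance, every distinct tuple with a given colour of a
    -- free type behaves like `seed`.
    Good : Fin τ × Bool → Set
    Good c = S (extend f c) (proj₁ seed)
    Good? : ∀ c → Dec (Good c)
    Good? c = S? (extend f c) (proj₁ seed)

    seed-similar : ∀ {c} {P : Colouring} {β : Tuple} → Distinct β → P (index β) ≡ c →
      Similar (extend f c) P (proj₁ seed) β
    seed-similar {c} d eq = Similar-distinct (proj₁ (proj₂ seed)) d
      (trans (cong (extend f c) (proj₂ (proj₂ seed))) (sym eq))

    fix-colour : ∀ t s → t ∉ˡ D → Good (t , s) → Fixing f D 1 (λ P α → ∃ λ a → S P (α [ y ≔ a ]))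
    fix-colour t s t∉D good = record
      { signs     = f [ t ≔ s ]
      ; fixed     = t ∷ D
      ; restricts = fix-admits t∉D
      ; short     = ≤-reflexive (+-comm 1 (length D))
      ; invariant = λ {P} {P′} adm adm′ sim →
          respond {f} {D} {S} inv y (fix-admits t∉D adm) (fix-admits t∉D adm′) sim
            (λ β _ _ → answer P′ adm′)
      }
      where
      answer : ∀ P′ → Admits (f [ t ≔ s ]) (t ∷ D) P′ →
        ∃ λ i → ∀ γ → Distinct γ → index γ ≡ i → S P′ γ
      answer P′ adm′ with hits adm′ t
      ... | i , eq = i , λ γ d index≡i →
        inv (extend-admits t∉D) (fix-admits t∉D adm′)
          (seed-similar d (trans (cong P′ index≡i) P′i≡)) good
        where
        P′i≡ : P′ i ≡ (t , s)
        P′i≡ = cong₂ _,_ eq (trans (agrees adm′ i (here eq))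
          (trans (cong (f [ t ≔ s ]) eq) (updateAt-updates t f)))

    by-search : Dec (∃ λ t → t ∉ˡ D × (Good (t , true) ⊎ Good (t , false))) →
      Fixing f D 1 (λ P α → ∃ λ a → S P (α [ y ≔ a ]))
    by-search (yes (t , t∉D , inj₁ good)) = fix-colour t true t∉D good
    by-search (yes (t , t∉D , inj₂ good)) = fix-colour t false t∉D good
    by-search (no none) = record
      { signs     = f
      ; fixed     = D
      ; restricts = id
      ; short     = m≤m+n (length D) 1
      ; invariant = λ {P} {P′} adm adm′ sim → respond {f} {D} {S} inv y adm adm′ sim (answer P P′ adm adm′)
      }
      where
      not-good : ∀ t s → t ∉ˡ D → ¬ Good (t , s)
      not-good t true  t∉D good = none (t , t∉D , inj₁ good)
      not-good t false t∉D good = none (t , t∉D , inj₂ good)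
      answer : ∀ P P′ → Admits f D P → Admits f D P′ → ∀ β → Distinct β → S P β →
        ∃ λ i → ∀ γ → Distinct γ → index γ ≡ i → S P′ γ
      answer P P′ adm adm′ β d Sβ with hits adm′ (proj₁ (P (index β)))
      ... | i , eq = i , λ γ d′ index≡i →
        inv adm adm′ (Similar-distinct d d′ (trans (sym P′i≡) (cong P′ (sym index≡i)))) Sβ
        where
        t∈D : proj₁ (P (index β)) ∈ˡ D
        -- Were this type free, the witness `β` would show its colour to be good.
        t∈D = decidable-stable (∈ˡ-dec _≟_ _ D) λ t∉D → not-good _ _ t∉D
          (inv adm (extend-admits t∉D) (Similar-sym (seed-similar d refl)) Sβ)
        P′i≡ : P′ i ≡ P (index β)
        P′i≡ = cong₂ _,_ eq (trans (agrees adm′ i (subst (_∈ˡ D) (sym eq) t∈D))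
          (trans (cong f eq) (sym (agrees adm (index β) t∈D))))

  Sat : Formula signature k → Predicate
  Sat θ P α = structure P , α ⊨ θ

  -- The second formula starts from the signs fixed for the first, so both end up invariant under
  -- one common restriction.
  fix-both : ∀ {f D m n} {S S′ : Predicate} → Fixing f D m S →
    (∀ f′ D′ → Fixing f′ D′ n S′) →
    ∀ {S″ : Predicate} → (∀ {f′ D′} → Invariant f′ D′ S → Invariant f′ D′ S′ → Invariant f′ D′ S″) →
    Fixing f D (3 + (m + n)) S″
  fix-both {f} {D} {m} {n} {S} {S′} first next combine = record
    { signs     = signs second
    ; fixed     = fixed second
    ; restricts = restricts first ∘ restricts second
    ; short     = ≤-trans (short second) (≤-trans (+-monoˡ-≤ n (short first))
        (≤-trans (≤-reflexive (+-assoc (length D) m n)) (+-monoʳ-≤ (length D) (m≤n+m (m + n) 3))))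
    ; invariant = combine
        (λ adm adm′ → invariant first (restricts second adm) (restricts second adm′))
        (invariant second)
    }
    where
    second : Fixing _ _ n S′
    second = next (signs first) (fixed first)

  -- The quantifier adds at most one type to those fixed for its body. `convert` also admits the
  -- universal quantifier, as the dual of an existential one.
  fix-quantifier : ∀ {f D n} {S S′ : Predicate} → (∀ P α → Dec (S P α)) → Fixing f D n S → ∀ y →
    (∀ {f′ D′} → Invariant f′ D′ (λ P α → ∃ λ a → S P (α [ y ≔ a ])) → Invariant f′ D′ S′) →
    Fixing f D (2 + n) S′
  fix-quantifier {f} {D} {n} {S} S? inner y convert = record
    { signs     = signs outer
    ; fixed     = fixed outer
    ; restricts = restricts inner ∘ restricts outer
    ; short     = ≤-trans (short outer) (≤-trans (+-monoˡ-≤ 1 (short inner))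
        (≤-trans (≤-reflexive (+-assoc (length D) n 1)) (+-monoʳ-≤ (length D)
          (≤-trans (≤-reflexive (+-comm n 1)) (m≤n+m (1 + n) 1)))))
    ; invariant = convert (invariant outer)
    }
    where
    outer : Fixing _ _ 1 (λ P α → ∃ λ a → S P (α [ y ≔ a ]))
    outer = fix-∃ S? (invariant inner) y

  ¬-invariant : ∀ {f D} {S : Predicate} → Invariant f D S → Invariant f D (λ P α → ¬ S P α)
  ¬-invariant inv adm adm′ s ¬S S′ = ¬S (inv adm′ adm (Similar-sym s) S′)

  fix : ∀ θ f D → Fixing f D (size θ) (Sat θ)
  fix (atom R ys) f D = record
    { signs = f ; fixed = D ; restricts = id ; short = m≤m+n (length D) _
    ; invariant = λ _ _ s → atom-transfer s R ys }
  fix (x ≐ y) f D = record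
    { signs = f ; fixed = D ; restricts = id ; short = m≤m+n (length D) 3
    ; invariant = λ _ _ s → to s x y }
  fix (¬̇ θ) f D = record
    { signs     = signs inner
    ; fixed     = fixed inner
    ; restricts = restricts inner
    ; short     = ≤-trans (short inner) (+-monoʳ-≤ (length D) (m≤n+m (size θ) 1))
    ; invariant = ¬-invariant {S = Sat θ} (invariant inner)
    }
    where
    inner : Fixing f D (size θ) (Sat θ)
    inner = fix θ f D
  fix (θ ∧̇ χ) f D = fix-both (fix θ f D) (fix χ)
    (λ inv inv′ adm adm′ s (p , q) → inv adm adm′ s p , inv′ adm adm′ s q)
  fix (θ ∨̇ χ) f D = fix-both (fix θ f D) (fix χ)
    (λ { inv inv′ adm adm′ s (inj₁ p) → inj₁ (inv adm adm′ s p)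
       ; inv inv′ adm adm′ s (inj₂ q) → inj₂ (inv′ adm adm′ s q) })
  fix (∃̇ y θ) f D = fix-quantifier {S = Sat θ} (λ P α → structure P , α ⊨? θ) (fix θ f D) y id
  -- A counterexample on the primed side is carried back as a witness for `¬̇ θ`.
  fix (∀̇ y θ) f D = fix-quantifier {S = Sat (¬̇ θ)} (λ P α → structure P , α ⊨? ¬̇ θ)
    (record
      { signs = signs inner ; fixed = fixed inner ; restricts = restricts inner ; short = short inner
      ; invariant = ¬-invariant {S = Sat θ} (invariant inner) })
    y
    (λ inv {P} {P′} {α} {α′} adm adm′ s all a → decidable-stable (structure P′ , α′ [ y ≔ a ] ⊨? θ) λ ¬θ →
      let b , ¬θb = inv adm′ adm (Similar-sym s) (a , ¬θ) in ¬θb (all b))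
    where
    inner : Fixing f D (size θ) (Sat θ)
    inner = fix θ f D

  -- A sentence must hold under all assignments, so each tuple over `P′` needs a similar one over
  -- `P`. Therefore `covers` finds the colours of `P′` in `P`.
  ⊨-transfer : ∀ {f D P P′} (ψ : Sentence signature k) → Invariant f D (Sat (proj₁ ψ)) →
    Admits f D P → Admits f D P′ → (∀ i → ∃ λ j → P j ≡ P′ i) → structure P ⊨ ψ → structure P′ ⊨ ψ
  ⊨-transfer {P = P} {P′} ψ inv adm adm′ covers P⊨ψ α = by-kind (distinct? α)
    where
    by-kind : Dec (Distinct α) → structure P′ , α ⊨ proj₁ ψ
    by-kind (no ¬d) = inv adm adm′
      (record { to = λ _ _ → id ; from = λ _ _ → id ; colour = λ d → contradiction d ¬d }) (P⊨ψ α)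
    by-kind (yes d) =
      let j , Pj≡ = covers (index α)
          a , fresh , index≡j = realise α zero j
      in inv adm adm′
           (Similar-distinct (update-distinct zero (λ x _ → fresh x) d) d (trans (cong P index≡j) Pj≡))
           (P⊨ψ (α [ zero ≔ a ]))

-- Existential closure and biconditionals.

≔-cong : ∀ {k} {A : Set} {α β : Vector A k} y {a} → α ≗ β → α [ y ≔ a ] ≗ β [ y ≔ a ]
≔-cong {α = α} {β} y α≗β x with x ≟ y
... | yes refl = trans (updateAt-updates x α) (sym (updateAt-updates x β))
... | no x≢y   = trans (updateAt-minimal x y α x≢y) (trans (α≗β x) (sym (updateAt-minimal x y β x≢y)))

module _ {σ : Signature} {k : ℕ} where

  ⊨-cong : ∀ {A : Structure σ} (θ : Formula σ k) {α β} → α ≗ β → A , α ⊨ θ → A , β ⊨ θ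
  ⊨-cong {A} (atom R ys) α≗β p = subst (T ∘ rel A R) (map-cong α≗β ys) p
  ⊨-cong (x ≐ y) α≗β p = trans (sym (α≗β x)) (trans p (α≗β y))
  ⊨-cong (¬̇ θ) α≗β ¬p p = ¬p (⊨-cong θ (sym ∘ α≗β) p)
  ⊨-cong (θ ∧̇ χ) α≗β (p , q) = ⊨-cong θ α≗β p , ⊨-cong χ α≗β q
  ⊨-cong (θ ∨̇ χ) α≗β (inj₁ p) = inj₁ (⊨-cong θ α≗β p)
  ⊨-cong (θ ∨̇ χ) α≗β (inj₂ q) = inj₂ (⊨-cong χ α≗β q)
  ⊨-cong (∃̇ y θ) α≗β (a , p) = a , ⊨-cong θ (≔-cong y α≗β) p
  ⊨-cong (∀̇ y θ) α≗β p a = ⊨-cong θ (≔-cong y α≗β) (p a)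

  ∃̇* : List (Fin k) → Formula σ k → Formula σ k
  ∃̇* ys θ = foldr ∃̇ θ ys

  ∃̇*-binds : ∀ {x θ} ys → FreeIn x (∃̇* ys θ) → x ∉ˡ ys
  ∃̇*-binds (y ∷ ys) (x≢y , _)    (here x≡y)   = x≢y x≡y
  ∃̇*-binds (y ∷ ys) (_ , x-free) (there x∈ys) = ∃̇*-binds ys x-free x∈ys

  size-∃̇* : ∀ ys {θ} → size (∃̇* ys θ) ≡ 2 * length ys + size θ
  size-∃̇* [] = refl
  size-∃̇* (y ∷ ys) {θ} rewrite size-∃̇* ys {θ} =
    solve 2 (λ l s → con 2 :+ (con 2 :* l :+ s) := con 2 :* (con 1 :+ l) :+ s) refl (length ys) (size θ)
    where open +-*-Solver

  ∃̇*-intro : ∀ {A : Structure σ} {θ} ys {α β} → (∀ x → x ∉ˡ ys → α x ≡ β x) →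
    A , β ⊨ θ → A , α ⊨ ∃̇* ys θ
  ∃̇*-intro {θ = θ} [] agree p = ⊨-cong θ (λ x → sym (agree x λ ())) p
  ∃̇*-intro {A} {θ} (y ∷ ys) {α} {β} agree p = β y , ∃̇*-intro ys agree′ p
    where
    agree′ : ∀ x → x ∉ˡ ys → (α [ y ≔ β y ]) x ≡ β x
    agree′ x x∉ys with x ≟ y
    ... | yes refl = updateAt-updates x α
    ... | no x≢y   = trans (updateAt-minimal x y α x≢y)
      (agree x λ { (here x≡y) → x≢y x≡y ; (there x∈ys) → x∉ys x∈ys })

  ∃̇*-elim : ∀ {A : Structure σ} {θ} ys {α} → A , α ⊨ ∃̇* ys θ → ∃ λ β → A , β ⊨ θ
  ∃̇*-elim []       {α} p = α , p
  ∃̇*-elim (y ∷ ys) (a , p) = ∃̇*-elim ys p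

  -- Binding all variables, occurring or not, makes closedness immediate at a cost that depends on
  -- `k` only.
  close : Formula σ k → Sentence σ k
  close θ = ∃̇* (allFin k) θ , λ x x-free → ∃̇*-binds (allFin k) x-free (∈-allFin x)

  ⊨-close : ∀ {A : Structure σ} {θ} → (A ⊨ close θ) ⇔ (∃ λ β → A , β ⊨ θ)
  ⊨-close {A} {θ} = mk⇔
    (λ p → ∃̇*-elim (allFin k) (p (const (point A))))
    (λ (β , p) α → ∃̇*-intro (allFin k) (λ x x∉ → contradiction (∈-allFin x) x∉) p)
    where
    point : (A : Structure σ) → Universe A
    point record { card = suc _ } = zero

  infix 5 _⇔̇_

  _⇔̇_ : Formula σ k → Formula σ k → Formula σ k
  θ ⇔̇ χ = (θ ∧̇ χ) ∨̇ (¬̇ θ ∧̇ ¬̇ χ)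

  ⊨-⇔̇ : ∀ {A : Structure σ} {α} θ χ → (A , α ⊨ (θ ⇔̇ χ)) ⇔ ((A , α ⊨ θ) ⇔ (A , α ⊨ χ))
  ⊨-⇔̇ {A} {α} θ χ = mk⇔
    (λ { (inj₁ (p , q))   → mk⇔ (const q) (const p)
       ; (inj₂ (¬p , ¬q)) → mk⇔ (λ p → contradiction p ¬p) (λ q → contradiction q ¬q) })
    (λ equiv → by-truth equiv (A , α ⊨? θ))
    where
    by-truth : (A , α ⊨ θ) ⇔ (A , α ⊨ χ) → Dec (A , α ⊨ θ) → A , α ⊨ (θ ⇔̇ χ)
    by-truth equiv (yes p) = inj₁ (p , Equivalence.to equiv p)
    by-truth equiv (no ¬p) = inj₂ (¬p , ¬p ∘ Equivalence.from equiv)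

-- The short and the long sentence expressing a clash.

module Clashes (m k′ : ℕ) where

  σ : Signature
  σ = uniform (2 + m) k′

  Holds : (A : Structure σ) → Symbol σ → Universe A → Vector (Universe A) k′ → Set
  Holds A R y xs = T (rel A R (y ∷ tabulate xs))

  -- The varied element is always the first one. Symbols `zero` and `suc zero` play `Q⁺` and `Q⁻`,
  -- and `suc (suc j)` plays `R_j`.
  Clash : Structure σ → Set
  Clash A = ∃ λ xs → ∃ λ y → ∃ λ z → Holds A zero y xs × Holds A (suc zero) z xs ×
    (∀ j → Holds A (suc (suc j)) y xs ⇔ Holds A (suc (suc j)) z xs)

  ⊨-atom : ∀ {n} {A : Structure σ} {β : Assignment A n} R v (f : Fin k′ → Fin n) →
    (A , β ⊨ atom R (v ∷ tabulate f)) ≡ Holds A R (β v) (β ∘ f)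
  ⊨-atom {A = A} {β} R v f = cong (λ w → T (rel A R (β v ∷ w))) (sym (tabulate-∘ β f))

  others : Fin k′ → Fin (2 + k′)
  others i = suc (suc i)

  first second : Symbol σ → Formula σ (2 + k′)
  first  R = atom R (zero ∷ tabulate others)
  second R = atom R (suc zero ∷ tabulate others)

  same : Fin m → Formula σ (2 + k′)
  same j = first (suc (suc j)) ⇔̇ second (suc (suc j))

  clash : List (Fin m) → Formula σ (2 + k′)
  clash = foldr (λ j θ → same j ∧̇ θ) (first zero ∧̇ second (suc zero))

  clashing : ∀ {A β} js → (A , β ⊨ clash js) ⇔
    ((A , β ⊨ clash []) × (∀ j → j ∈ˡ js → A , β ⊨ same j))
  clashing [] = mk⇔ (λ p → p , λ _ ()) proj₁
  clashing (j ∷ js) = mk⇔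
    (λ (p , q) → let base , rest = Equivalence.to (clashing js) q in
      base , λ { j (here refl) → p ; j (there j∈js) → rest j j∈js })
    (λ (base , rest) → rest j (here refl) ,
      Equivalence.from (clashing js) (base , λ i i∈js → rest i (there i∈js)))

  short : Sentence σ (2 + k′)
  short = close (clash (allFin m))

  ⊨-short : ∀ {A} → (A ⊨ short) ⇔ Clash A
  ⊨-short {A} = mk⇔ to from
    where
    to : A ⊨ short → Clash A
    to p =
      let β , q = Equivalence.to (⊨-close {A = A}) p
          (base₁ , base₂) , rest = Equivalence.to (clashing {A} {β} (allFin m)) q
      in β ∘ others , β zero , β (suc zero)
       , subst id (⊨-atom {A = A} {β} zero zero others) base₁
       , subst id (⊨-atom {A = A} {β} (suc zero) (suc zero) others) base₂
       , λ j → subst₂ _⇔_ (⊨-atom {A = A} {β} (suc (suc j)) zero others) (⊨-atom {A = A} {β} (suc (suc j)) (suc zero) others)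
           (Equivalence.to (⊨-⇔̇ {A = A} {β} (first (suc (suc j))) (second (suc (suc j)))) (rest j (∈-allFin j)))
    from : Clash A → A ⊨ short
    from (xs , y , z , p , q , r) = Equivalence.from (⊨-close {A = A}) (β ,
      Equivalence.from (clashing {A} {β} (allFin m))
        ( ( subst id (sym (⊨-atom {A = A} {β} zero zero others)) p
          , subst id (sym (⊨-atom {A = A} {β} (suc zero) (suc zero) others)) q )
        , λ j _ → Equivalence.from (⊨-⇔̇ {A = A} {β} (first (suc (suc j))) (second (suc (suc j))))
            (subst₂ _⇔_ (sym (⊨-atom {A = A} {β} (suc (suc j)) zero others))
              (sym (⊨-atom {A = A} {β} (suc (suc j)) (suc zero) others)) (r j))))
      where
      β : Assignment A (2 + k′)
      β zero          = y
      β (suc zero)    = z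
      β (suc (suc i)) = xs i

  -- The size of `same j`, with atoms of size `2 + k′`. It does not grow with `m`, so `short` has
  -- size linear in `m`.
  size-same : ℕ
  size-same = 3 + ((3 + ((2 + k′) + (2 + k′))) + (3 + ((3 + k′) + (3 + k′))))

  size-clash : ∀ js → size (clash js) ≡ length js * (3 + size-same) + (3 + ((2 + k′) + (2 + k′)))
  size-clash [] = refl
  size-clash (j ∷ js) rewrite size-clash js =
    solve 3 (λ s l b → con 3 :+ (s :+ (l :* (con 3 :+ s) :+ b)) := (con 3 :+ s) :+ l :* (con 3 :+ s) :+ b) refl
      size-same (length js) (3 + ((2 + k′) + (2 + k′)))
    where open +-*-Solver

  size-short : ∥ short ∥ ≡ 2 * (2 + k′) + (m * (3 + size-same) + (3 + ((2 + k′) + (2 + k′))))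
  size-short = trans (size-∃̇* (allFin (2 + k′))) (cong₂ _+_
    (cong (2 *_) (length-tabulate {n = 2 + k′} id))
    (trans (size-clash (allFin m))
      (cong (λ l → l * (3 + size-same) + (3 + ((2 + k′) + (2 + k′)))) (length-tabulate {n = m} id))))

  own : Symbol σ → Formula σ (suc k′)
  own R = atom R (zero ∷ tabulate suc)

  -- `g` collects the literals of the current branch. Once all `R_j` are decided, two separate
  -- quantifiers over one variable suffice, as both witnesses satisfy `g` and so have the same type.
  split : List (Fin m) → Formula σ (suc k′) → Formula σ (suc k′)
  split [] g       = ∃̇ zero (own zero ∧̇ g) ∧̇ ∃̇ zero (own (suc zero) ∧̇ g)
  split (j ∷ js) g = split js (own (suc (suc j)) ∧̇ g) ∨̇ split js (¬̇ own (suc (suc j)) ∧̇ g)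

  Split : ∀ A → Assignment A (suc k′) → List (Fin m) → Formula σ (suc k′) → Set
  Split A α js g = ∃ λ y → ∃ λ z →
    ((A , α [ zero ≔ y ] ⊨ own zero) × (A , α [ zero ≔ z ] ⊨ own (suc zero))) ×
    ((A , α [ zero ≔ y ] ⊨ g) × (A , α [ zero ≔ z ] ⊨ g)) ×
    (∀ j → j ∈ˡ js → (A , α [ zero ≔ y ] ⊨ own (suc (suc j))) ⇔ (A , α [ zero ≔ z ] ⊨ own (suc (suc j))))

  split-to : ∀ {A α} js g → A , α ⊨ split js g → Split A α js g
  split-to [] g ((y , p , q) , (z , p′ , q′)) = y , z , (p , p′) , (q , q′) , λ _ ()
  split-to (j ∷ js) g (inj₁ s) with split-to js _ s
  ... | y , z , base , ((r , q) , (r′ , q′)) , rest =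
    y , z , base , (q , q′) , λ { j (here refl) → mk⇔ (const r′) (const r) ; i (there i∈js) → rest i i∈js }
  split-to (j ∷ js) g (inj₂ s) with split-to js _ s
  ... | y , z , base , ((r , q) , (r′ , q′)) , rest =
    y , z , base , (q , q′) , λ
      { j (here refl) → mk⇔ (λ t → contradiction t r) (λ t → contradiction t r′)
      ; i (there i∈js) → rest i i∈js }

  split-from : ∀ {A α} js g → Split A α js g → A , α ⊨ split js g
  split-from [] g (y , z , (p , p′) , (q , q′) , _) = (y , p , q) , (z , p′ , q′)
  split-from {A} {α} (j ∷ js) g (y , z , base , (q , q′) , rest)
    with A , α [ zero ≔ y ] ⊨? own (suc (suc j))
  ... | yes r = inj₁ (split-from js _ (y , z , base , ((r , q) , (Equivalence.to (rest j (here refl)) r , q′)) ,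
    λ i i∈js → rest i (there i∈js)))
  ... | no ¬r = inj₂ (split-from js _ (y , z , base , ((¬r , q) , (¬r ∘ Equivalence.from (rest j (here refl)) , q′)) ,
    λ i i∈js → rest i (there i∈js)))

  long : Sentence σ (suc k′)
  -- The true formula `zero ≐ zero` serves as the empty conjunction of literals.
  long = close (split (allFin m) (zero ≐ zero))

  ⊨-long : ∀ {A} → (A ⊨ long) ⇔ Clash A
  ⊨-long {A} = mk⇔ to from
    where
    own≡ : ∀ (α : Assignment A (suc k′)) y R →
      (A , α [ zero ≔ y ] ⊨ own R) ≡ Holds A R y (α ∘ suc)
    own≡ α y R = ⊨-atom {A = A} {α [ zero ≔ y ]} R zero suc
    to : A ⊨ long → Clash A
    to p =
      let α , q = Equivalence.to (⊨-close {A = A}) p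
          y , z , (p₁ , p₂) , _ , rest = split-to {A} {α} (allFin m) _ q
      in α ∘ suc , y , z , subst id (own≡ α y _) p₁ , subst id (own≡ α z _) p₂
       , λ j → subst₂ _⇔_ (own≡ α y _) (own≡ α z _) (rest j (∈-allFin j))
    from : Clash A → A ⊨ long
    from (xs , y , z , p , q , r) = Equivalence.from (⊨-close {A = A}) (α ,
      split-from {A} {α} (allFin m) _ (y , z ,
        (subst id (sym (own≡ α y _)) p , subst id (sym (own≡ α z _)) q) , (refl , refl) ,
        λ j _ → subst₂ _⇔_ (sym (own≡ α y _)) (sym (own≡ α z _)) (r j)))
      where
      α : Assignment A (suc k′)
      α zero    = y
      α (suc i) = xs i

-- Types as bit strings.

funToFin-cong : ∀ {m n} {f g : Fin m → Fin n} → f ≗ g → funToFin f ≡ funToFin g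
funToFin-cong {zero}  f≗g = refl
funToFin-cong {suc m} f≗g = cong₂ combine (f≗g zero) (funToFin-cong (f≗g ∘ suc))

isZero : Fin 2 → Bool
isZero zero    = true
isZero (suc _) = false

isZero-injective : ∀ x y → T (isZero x) ⇔ T (isZero y) → x ≡ y
isZero-injective zero       zero       _ = refl
isZero-injective zero       (suc zero) e = contradiction (Equivalence.to e tt) λ ()
isZero-injective (suc zero) zero       e = contradiction (Equivalence.from e tt) λ ()
isZero-injective (suc zero) (suc zero) _ = refl

bit : ∀ m → Fin (2 ^ m) → Fin m → Bool
bit m t j = isZero (finToFun {2} {m} t j)

-- A clash compares types only through the `R_j`; this turns such agreement into equality.
bit-injective : ∀ m (t u : Fin (2 ^ m)) → (∀ j → T (bit m t j) ⇔ T (bit m u j)) → t ≡ u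
bit-injective m t u same = begin
  t                                ≡⟨ funToFin-finToFin {m} {2} t ⟨
  funToFin (finToFun {2} {m} t)    ≡⟨ funToFin-cong {m} {2} (λ j → isZero-injective _ _ (same j)) ⟩
  funToFin (finToFun {2} {m} u)    ≡⟨ funToFin-finToFin {m} {2} u ⟩
  u                                ∎
  where open ≡-Reasoning

-- The lower bound for sentences with `k` variables.

module LowerBound (m k′ : ℕ) where

  holds : Fin (2 + m) → Fin (2 ^ m) × Bool → Bool
  holds zero          (t , s) = s
  holds (suc zero)    (t , s) = not s
  holds (suc (suc j)) (t , s) = bit m t j

  open Clashes m k′
  open Coloured {2 ^ m} {2 + m} k′ holds

  Holds-structure : ∀ (P : Colouring) R (α : Tuple) y →
    Holds (structure P) R y (α ∘ suc) ⇔ (Distinct (α [ zero ≔ y ]) × T (holds R (P (index (α [ zero ≔ y ])))))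
  Holds-structure P R α y = mk⇔
    (λ h → let d , t = Equivalence.to (T-rel P R v) h in
      (λ i j eq → d i j (trans (lookup-v i) (trans eq (sym (lookup-v j))))) , subst (T ∘ holds R ∘ P) index≡ t)
    (λ (d , t) → Equivalence.from (T-rel P R v)
      ( (λ i j eq → d i j (trans (sym (lookup-v i)) (trans eq (lookup-v j))))
      , subst (T ∘ holds R ∘ P) (sym index≡) t ))
    where
    v : Vec Point (suc k′)
    v = y ∷ tabulate (α ∘ suc)
    lookup-v : lookup v ≗ α [ zero ≔ y ]
    lookup-v zero    = refl
    lookup-v (suc i) = lookup∘tabulate (α ∘ suc) i
    index≡ : index (lookup v) ≡ index (α [ zero ≔ y ])
    index≡ = index-cong lookup-v

  -- The first entry of `seed` is replaced once to reach index `i` and once to reach index `j`.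
  clash-intro : ∀ {P : Colouring} {t} i j → P i ≡ (t , true) → P j ≡ (t , false) → Clash (structure P)
  clash-intro {P} {t} i j Pi≡ Pj≡ =
    α ∘ suc , y , z , Holds-i zero tt , Holds-j (suc zero) tt ,
    λ l → mk⇔ (λ h → Holds-j (suc (suc l)) (bit-i l h)) (λ h → Holds-i (suc (suc l)) (bit-j l h))
    where
    α : Tuple
    α = proj₁ seed
    y z : Point
    y = proj₁ (realise α zero i)
    z = proj₁ (realise α zero j)
    colour-i : P (index (α [ zero ≔ y ])) ≡ (t , true)
    colour-i = trans (cong P (proj₂ (proj₂ (realise α zero i)))) Pi≡
    colour-j : P (index (α [ zero ≔ z ])) ≡ (t , false)
    colour-j = trans (cong P (proj₂ (proj₂ (realise α zero j)))) Pj≡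
    Holds-i : ∀ R → T (holds R (t , true)) → Holds (structure P) R y (α ∘ suc)
    Holds-i R h = Equivalence.from (Holds-structure P R α y)
      ( update-distinct zero (λ x _ → proj₁ (proj₂ (realise α zero i)) x) (proj₁ (proj₂ seed))
      , subst (T ∘ holds R) (sym colour-i) h )
    Holds-j : ∀ R → T (holds R (t , false)) → Holds (structure P) R z (α ∘ suc)
    Holds-j R h = Equivalence.from (Holds-structure P R α z)
      ( update-distinct zero (λ x _ → proj₁ (proj₂ (realise α zero j)) x) (proj₁ (proj₂ seed))
      , subst (T ∘ holds R) (sym colour-j) h )
    bit-i : ∀ l → Holds (structure P) (suc (suc l)) y (α ∘ suc) → T (bit m t l)
    bit-i l h = subst (T ∘ holds (suc (suc l))) colour-i (proj₂ (Equivalence.to (Holds-structure P (suc (suc l)) α y) h))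
    bit-j : ∀ l → Holds (structure P) (suc (suc l)) z (α ∘ suc) → T (bit m t l)
    bit-j l h = subst (T ∘ holds (suc (suc l))) colour-j (proj₂ (Equivalence.to (Holds-structure P (suc (suc l)) α z) h))

  clash-elim : ∀ {P : Colouring} → Clash (structure P) →
    ∃ λ i → ∃ λ j → proj₁ (P i) ≡ proj₁ (P j) × T (proj₂ (P i)) × T (not (proj₂ (P j)))
  clash-elim {P} (xs , y , z , p , q , r) =
    index (α [ zero ≔ y ]) , index (α [ zero ≔ z ]) ,
    bit-injective m _ _ (λ l → mk⇔
      (λ h → proj₂ (to-z (suc (suc l)) (Equivalence.to (r l) (from-y (suc (suc l)) h))))
      (λ h → proj₂ (to-y (suc (suc l)) (Equivalence.from (r l) (from-z (suc (suc l)) h))))) ,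
    proj₂ (to-y zero p) , proj₂ (to-z (suc zero) q)
    where
    α : Tuple
    α zero    = y
    α (suc i) = xs i
    to-y : ∀ R → Holds (structure P) R y xs →
      Distinct (α [ zero ≔ y ]) × T (holds R (P (index (α [ zero ≔ y ]))))
    to-y R = Equivalence.to (Holds-structure P R α y)
    to-z : ∀ R → Holds (structure P) R z xs →
      Distinct (α [ zero ≔ z ]) × T (holds R (P (index (α [ zero ≔ z ]))))
    to-z R = Equivalence.to (Holds-structure P R α z)
    from-y : ∀ R → T (holds R (P (index (α [ zero ≔ y ])))) → Holds (structure P) R y xs
    from-y R h = Equivalence.from (Holds-structure P R α y) (proj₁ (to-y zero p) , h)
    from-z : ∀ R → T (holds R (P (index (α [ zero ≔ z ])))) → Holds (structure P) R z xs
    from-z R h = Equivalence.from (Holds-structure P R α z) (proj₁ (to-z (suc zero) q) , h)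

  -- The extra colour repeats one already present, so every type has a single sign.
  duplicate-clashless : ∀ f t → ¬ Clash (structure (extend f (t , f t)))
  duplicate-clashless f t c with clash-elim c
  ... | i , j , same , Ti , Tj = conflict (f (proj₁ (P i)))
    (subst T (sign i) Ti) (subst (T ∘ not) (trans (sign j) (cong f (sym same))) Tj)
    where
    P : Colouring
    P = extend f (t , f t)
    sign : ∀ i → proj₂ (P i) ≡ f (proj₁ (P i))
    sign zero    = refl
    sign (suc _) = refl
    conflict : ∀ b → T b → ¬ T (not b)
    conflict true _ ()

  opposite-clash : ∀ f t → Clash (structure (extend f (t , not (f t))))
  opposite-clash f t = by-sign (f t) refl
    where
    P : Colouring
    P = extend f (t , not (f t))
    by-sign : ∀ b → f t ≡ b → Clash (structure P)
    by-sign true  eq = clash-intro {P} (suc t) zero (cong (t ,_) eq) (cong (λ b → t , not b) eq)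
    by-sign false eq = clash-intro {P} zero (suc t) (cong (λ b → t , not b) eq) (cong (t ,_) eq)

  lower-bound : ∀ (ψ : Sentence σ (suc k′)) → short ≣ ψ → 2 ^ m ≤ ∥ ψ ∥
  lower-bound ψ short≣ψ = ≤-trans
    (injective⇒≤ {f = λ t → Any.index (all-fixed t)}
      (λ {t} {u} → index-injective (setoid _) (all-fixed t) (all-fixed u)))
    (Fixing.short fixing)
    where
    fixing : Fixing (const true) [] ∥ ψ ∥ (Sat (proj₁ ψ))
    fixing = fix (proj₁ ψ) (const true) []
    f : Fin (2 ^ m) → Bool
    f = Fixing.signs fixing
    all-fixed : ∀ t → t ∈ˡ Fixing.fixed fixing
    all-fixed t = decidable-stable (∈ˡ-dec _≟_ t _) λ t∉D →
      duplicate-clashless f t (Equivalence.to ⊨-short (Equivalence.from (short≣ψ (structure P₀))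
        (⊨-transfer ψ (Fixing.invariant fixing) (extend-admits t∉D) (extend-admits t∉D) covers
          (Equivalence.to (short≣ψ (structure P₁)) (Equivalence.from ⊨-short (opposite-clash f t))))))
      where
      P₀ P₁ : Colouring
      P₀ = extend f (t , f t)
      P₁ = extend f (t , not (f t))
      covers : ∀ i → ∃ λ j → P₁ j ≡ P₀ i
      -- The extra colour of `P₀` duplicates the one at `suc t`, which `P₁` has too.
      covers zero    = suc t , refl
      covers (suc u) = suc u , refl

theorem2 : (k : ℕ) → 3 ≤ k →
    Σ[ ε ∈ ℚ ] Positive ε ×
    ((n : ℕ) →
    Σ[ σ ∈ Signature ] Σ[ φ ∈ Sentence σ (suc k) ]
    n ≤ ∥ φ ∥ ×
    (Σ[ ψ ∈ Sentence σ k ] φ ≣ ψ) ×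
    ((ψ : Sentence σ k) → φ ≣ ψ → 2^[ ε · ∥ φ ∥ ]≤ ∥ ψ ∥))
-- `mkℚ` takes the denominator minus one, so ε is `1 / (rate + 1)`. With `suc n` symbols `R_j`, at
-- least one is present, and `suc n * c₀` absorbs the constant part `c₀` of the size.
theorem2 (suc k′) _ = mkℚ 1ℤ rate (1-coprimeTo (suc rate)) , _ , λ n →
  let open Clashes (suc n) k′ in
  σ , short
  , ≤-trans (n≤1+n n) (m≤∥short∥ (suc n))
  , (long , λ A → mk⇔ (Equivalence.from ⊨-long ∘ Equivalence.to ⊨-short)
                       (Equivalence.from ⊨-short ∘ Equivalence.to ⊨-long))
  , λ ψ short≣ψ → begin
      2 ^ (1 * ∥ short ∥)          ≡⟨ cong (2 ^_) (*-identityˡ ∥ short ∥) ⟩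
      2 ^ ∥ short ∥                ≤⟨ ^-monoʳ-≤ 2 (∥short∥≤ n) ⟩
      2 ^ (suc n * suc rate)       ≡⟨ ^-*-assoc 2 (suc n) (suc rate) ⟨
      (2 ^ suc n) ^ suc rate       ≤⟨ ^-monoˡ-≤ (suc rate) (LowerBound.lower-bound (suc n) k′ ψ short≣ψ) ⟩
      ∥ ψ ∥ ^ suc rate             ∎
  where
  open ≤-Reasoning
  c₀ c₁ rate : ℕ
  c₀ = 2 * (2 + k′) + (3 + ((2 + k′) + (2 + k′)))
  -- `size-same` has the same value for every number of symbols; `0` is a placeholder.
  c₁ = 3 + Clashes.size-same 0 k′
  rate = c₀ + c₁

  ∥short∥≡ : ∀ m → ∥ Clashes.short m k′ ∥ ≡ c₀ + m * c₁
  ∥short∥≡ m = trans (Clashes.size-short m k′)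
    (solve 3 (λ a b c → a :+ (b :+ c) := (a :+ c) :+ b) refl
      (2 * (2 + k′)) (m * c₁) (3 + ((2 + k′) + (2 + k′))))
    where open +-*-Solver

  m≤∥short∥ : ∀ m → m ≤ ∥ Clashes.short m k′ ∥
  m≤∥short∥ m = begin
    m                          ≤⟨ m≤m*n m c₁ ⟩
    m * c₁                     ≤⟨ m≤n+m (m * c₁) c₀ ⟩
    c₀ + m * c₁                ≡⟨ ∥short∥≡ m ⟨
    ∥ Clashes.short m k′ ∥     ∎

  ∥short∥≤ : ∀ n → ∥ Clashes.short (suc n) k′ ∥ ≤ suc n * suc rate
  ∥short∥≤ n = begin
    ∥ Clashes.short (suc n) k′ ∥  ≡⟨ ∥short∥≡ (suc n) ⟩
    c₀ + suc n * c₁               ≤⟨ +-monoˡ-≤ (suc n * c₁) (m≤n*m c₀ (suc n)) ⟩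
    suc n * c₀ + suc n * c₁       ≡⟨ *-distribˡ-+ (suc n) c₀ c₁ ⟨
    suc n * rate                  ≤⟨ *-monoʳ-≤ (suc n) (n≤1+n rate) ⟩
    suc n * suc rate              ∎
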